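{- Let $F\in\mathbb{Z}[x,y]$ be a polynomial of degree $2$ which represents arbitrarily large (positive) integers and such that $\frac{\partial F}{\partial x},\frac{\partial F}{\partial y}$ are linearly independent. If the image $F(\mathbb{Z}^2)$ contains an arithmetic progression $\{An+B: n\in\mathbb{Z}\}$ with $A,B\in\mathbb{Z}$, $A\neq0$, then $$N\ll\psi_F(N)\ll N.$$
   Context: An integer $n$ is represented by $F$ if $n=F(x_0,y_0)$ for some $x_0,y_0\in\mathbb{Z}$. For $N\ge1$, $\psi_F(N)=\log\left(\mathrm{LCM}\{F(x,y): x,y\in\mathbb{Z},\ 0<F(x,y)\le N\}\right)$. Linear independence is as polynomials over $\mathbb{Q}$. The estimates hold for all sufficiently large $N$, with positive implied constants that may depend on $F$. -}

module Defs where

open import Data.Nat.Base as ℕ using (ℕ; zero; suc; s≤s; NonZero)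
import Data.Nat.Properties as ℕ
open import Data.Nat.Divisibility using (_∣_; ∣-antisym; ∣-trans; 1∣_; 0∣⇒≡0; m∣m*n; n∣m*n)
open import Data.Nat.LCM using (lcm; m∣lcm[m,n]; n∣lcm[m,n]; lcm-least)
open import Data.Integer.Base as ℤ using (ℤ; +_; 0ℤ)
import Data.Integer.Properties as ℤ
open import Data.Rational.Base as ℚ using (ℚ; 0ℚ; _/_; toℚᵘ)
import Data.Rational.Properties as ℚ
import Data.Rational.Unnormalised.Base as ℚᵘ
import Data.Rational.Unnormalised.Properties as ℚᵘ
open import Data.Fin.Base using (toℕ)
open import Data.Product.Base using (_×_; _,_; ∃₂; proj₁; proj₂)
open import Data.Sum.Base using (_⊎_; inj₁; inj₂)
open import Data.Empty using (⊥-elim)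
open import Relation.Nullary using (¬_; Dec; yes; no)
open import Relation.Nullary.Decidable using (¬¬-excluded-middle)
open import Relation.Binary.PropositionalEquality
open import Algebra.Properties.Semiring.Sum ℤ.+-*-semiring using (sum⁺-syntax)
import Algebra.Properties.Group ℚ.+-0-group as ℚ-Group

-- coeff i j is the coefficient of xⁱyʲ.  The bound only witnesses finite
-- support and need not be sharp, so equality of polynomials is pointwise
-- equality of coefficients.
record ℤ[x,y] : Set where
  field
    coeff  : ℕ → ℕ → ℤ
    bound  : ℕ
    finite : ∀ i j → bound ℕ.< i ℕ.+ j → coeff i j ≡ 0ℤ

open ℤ[x,y] public

eval : ℤ[x,y] → ℤ → ℤ → ℤ
eval F x y =
  ∑[ i ≤ bound F ] ∑[ j ≤ bound F ]
    (coeff F (toℕ i) (toℕ j) ℤ.* (x ℤ.^ toℕ i ℤ.* y ℤ.^ toℕ j))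

HasDegree : ℤ[x,y] → ℕ → Set
HasDegree F d =
  (∀ i j → d ℕ.< i ℕ.+ j → coeff F i j ≡ 0ℤ) ×
  (∃₂ λ i j → i ℕ.+ j ≡ d × coeff F i j ≢ 0ℤ)

∂/∂x : ℤ[x,y] → ℤ[x,y]
∂/∂x F = record
  { coeff  = λ i j → + suc i ℤ.* coeff F (suc i) j
  ; bound  = bound F
  ; finite = λ i j lt → trans
      (cong (+ suc i ℤ.*_) (finite F (suc i) j (ℕ.m<n⇒m<1+n lt)))
      (ℤ.*-zeroʳ (+ suc i))
  }

∂/∂y : ℤ[x,y] → ℤ[x,y]
∂/∂y F = record
  { coeff  = λ i j → + suc j ℤ.* coeff F i (suc j)
  ; bound  = bound F
  ; finite = λ i j lt → trans
      (cong (+ suc j ℤ.*_) (finite F i (suc j)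
        (subst (bound F ℕ.<_) (sym (ℕ.+-suc i j)) (ℕ.m<n⇒m<1+n lt))))
      (ℤ.*-zeroʳ (+ suc j))
  }

LinearlyIndependentOverℚ : ℤ[x,y] → ℤ[x,y] → Set
LinearlyIndependentOverℚ G H =
  ∀ (s t : ℚ) →
  (∀ i j → s ℚ.* (coeff G i j / 1) ℚ.+ t ℚ.* (coeff H i j / 1) ≡ 0ℚ) →
  s ≡ 0ℚ × t ≡ 0ℚ

Represents : ℤ[x,y] → ℤ → Set
Represents F n = ∃₂ λ x y → n ≡ eval F x y

RepresentsArbitrarilyLarge : ℤ[x,y] → Set
RepresentsArbitrarilyLarge F = ∀ (M : ℤ) → ∃₂ λ x y → M ℤ.< eval F x y

1/1+_ : ℕ → ℚ
1/1+ n = + 1 / suc n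

-- Bishop's regular sequences of rationals.  The limit x satisfies
--   ∣ x - seq n ∣ ≤ 1/(n+1).
record ℝ : Set where
  field
    seq     : ℕ → ℚ
    regular : ∀ p q → ℚ.∣ seq p ℚ.- seq q ∣ ℚ.≤ 1/1+ p ℚ.+ 1/1+ q

open ℝ public

infix 4 _≤ℝ_

-- The slack 2/(n+1) is the sum of the two approximation errors, so this is
-- the order of the limits, not of the sequences.
_≤ℝ_ : ℝ → ℝ → Set
x ≤ℝ y = ∀ n → seq x n ℚ.≤ seq y n ℚ.+ (1/1+ n ℚ.+ 1/1+ n)

0≤1/1+ : ∀ n → 0ℚ ℚ.≤ 1/1+ n
0≤1/1+ n = ℚ.nonNegative⁻¹ (1/1+ n) {{ℚ.normalize-nonNeg 1 (suc n)}}

fromℚ : ℚ → ℝ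
fromℚ r = record
  { seq     = λ _ → r
  ; regular = λ p q → subst (ℚ._≤ 1/1+ p ℚ.+ 1/1+ q)
      (sym (cong ℚ.∣_∣ (ℚ.+-inverseʳ r)))
      (ℚ.+-mono-≤ (0≤1/1+ p) (0≤1/1+ q))
  }

-- harmonic a l = Σ_{a < k ≤ a+l} 1/k
harmonic : ℕ → ℕ → ℚ
harmonic a zero    = 0ℚ
harmonic a (suc l) = 1/1+ a ℚ.+ harmonic (suc a) l

-- The lower Riemann sum of ∫₁ᵐ dt/t with step 1/n, namely
-- Σ_{n < k ≤ mn} (1/n)·1/(k/n).
logSum : ℕ → ℕ → ℚ
logSum m n = harmonic n ((m ℕ.∸ 1) ℕ.* n)

1/1+-anti : ∀ {m n} → m ℕ.≤ n → 1/1+ n ℚ.≤ 1/1+ m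
1/1+-anti {m} {n} m≤n = ℚ.toℚᵘ-cancel-≤ (begin
  toℚᵘ (1/1+ n)         ≃⟨ ℚ.toℚᵘ-fromℚᵘ (ℚᵘ.mkℚᵘ (+ 1) n) ⟩
  ℚᵘ.mkℚᵘ (+ 1) n       ≤⟨ ℚᵘ.*≤* (ℤ.*-monoˡ-≤-nonNeg (+ 1) (ℤ.+≤+ (s≤s m≤n))) ⟩
  ℚᵘ.mkℚᵘ (+ 1) m       ≃⟨ ℚᵘ.≃-sym (ℚ.toℚᵘ-fromℚᵘ (ℚᵘ.mkℚᵘ (+ 1) m)) ⟩
  toℚᵘ (1/1+ m)         ∎)
  where open ℚᵘ.≤-Reasoning

times : ℕ → ℚ → ℚ
times zero    v = 0ℚ
times (suc l) v = v ℚ.+ times l v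

times-1/1+ : ∀ l n → toℚᵘ (times l (1/1+ n)) ℚᵘ.≃ ℚᵘ.mkℚᵘ (+ l) n
times-1/1+ zero    n = ℚᵘ.*≡* refl
times-1/1+ (suc l) n = begin
  toℚᵘ (1/1+ n ℚ.+ times l (1/1+ n))
    ≈⟨ ℚ.toℚᵘ-homo-+ (1/1+ n) (times l (1/1+ n)) ⟩
  toℚᵘ (1/1+ n) ℚᵘ.+ toℚᵘ (times l (1/1+ n))
    ≈⟨ ℚᵘ.+-cong (ℚ.toℚᵘ-fromℚᵘ (ℚᵘ.mkℚᵘ (+ 1) n)) (times-1/1+ l n) ⟩
  ℚᵘ.mkℚᵘ (+ 1) n ℚᵘ.+ ℚᵘ.mkℚᵘ (+ l) n
    ≈⟨ ℚᵘ.*≡* (trans (cong (ℤ._* + suc n)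
         (sym (ℤ.*-distribʳ-+ (+ suc n) (+ 1) (+ l))))
         (ℤ.*-assoc (+ suc l) (+ suc n) (+ suc n))) ⟩
  ℚᵘ.mkℚᵘ (+ suc l) n ∎
  where open import Relation.Binary.Reasoning.Setoid ℚᵘ.≃-setoid

times-cancel : ∀ q i → times (suc q) (1/1+ (q ℕ.+ i ℕ.* suc q)) ≡ 1/1+ i
times-cancel q i = ℚ.toℚᵘ-injective (ℚᵘ.≃-trans
  (times-1/1+ (suc q) (q ℕ.+ i ℕ.* suc q))
  (ℚᵘ.≃-trans
    (ℚᵘ.*≡* (trans (cong +_ (ℕ.*-comm (suc q) (suc i)))
                   (sym (ℤ.*-identityˡ (+ (suc i ℕ.* suc q))))))
    (ℚᵘ.≃-sym (ℚ.toℚᵘ-fromℚᵘ (ℚᵘ.mkℚᵘ (+ 1) i)))))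

times≤harmonic : ∀ a l t → a ℕ.+ l ℕ.≤ suc t → times l (1/1+ t) ℚ.≤ harmonic a l
times≤harmonic a zero    t le = ℚ.≤-refl
times≤harmonic a (suc l) t le = ℚ.+-mono-≤
  (1/1+-anti (ℕ.≤-trans (ℕ.m≤m+n a l) (ℕ.≤-pred le′)))
  (times≤harmonic (suc a) l t le′)
  where
  le′ : suc (a ℕ.+ l) ℕ.≤ suc t
  le′ = subst (ℕ._≤ suc t) (ℕ.+-suc a l) le

harmonic≤times : ∀ a l t → t ℕ.≤ a → harmonic a l ℚ.≤ times l (1/1+ t)
harmonic≤times a zero    t le = ℚ.≤-refl
harmonic≤times a (suc l) t le = ℚ.+-mono-≤
  (1/1+-anti le) (harmonic≤times (suc a) l t (ℕ.m≤n⇒m≤1+n le))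

harmonic-+ : ∀ a l k → harmonic a (l ℕ.+ k) ≡ harmonic a l ℚ.+ harmonic (l ℕ.+ a) k
harmonic-+ a zero    k = sym (ℚ.+-identityˡ _)
harmonic-+ a (suc l) k = begin
  1/1+ a ℚ.+ harmonic (suc a) (l ℕ.+ k)
    ≡⟨ cong (1/1+ a ℚ.+_) (harmonic-+ (suc a) l k) ⟩
  1/1+ a ℚ.+ (harmonic (suc a) l ℚ.+ harmonic (l ℕ.+ suc a) k)
    ≡⟨ sym (ℚ.+-assoc (1/1+ a) _ _) ⟩
  harmonic a (suc l) ℚ.+ harmonic (l ℕ.+ suc a) k
    ≡⟨ cong (λ b → harmonic a (suc l) ℚ.+ harmonic b k) (ℕ.+-suc l a) ⟩
  harmonic a (suc l) ℚ.+ harmonic (suc l ℕ.+ a) k ∎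
  where open ≡-Reasoning

harmonic-step : ∀ a l → harmonic a l ℚ.≤ harmonic a (suc l)
harmonic-step a zero    = subst (0ℚ ℚ.≤_) (sym (ℚ.+-identityʳ (1/1+ a))) (0≤1/1+ a)
harmonic-step a (suc l) = ℚ.+-monoʳ-≤ (1/1+ a) (harmonic-step (suc a) l)

refine-lower : ∀ i l q → harmonic i l ℚ.≤ harmonic (i ℕ.* suc q) (l ℕ.* suc q)
refine-lower i zero    q = ℚ.≤-refl
refine-lower i (suc l) q = begin
  1/1+ i ℚ.+ harmonic (suc i) l
    ≤⟨ ℚ.+-mono-≤ block (refine-lower (suc i) l q) ⟩
  harmonic (i ℕ.* suc q) (suc q) ℚ.+ harmonic (suc i ℕ.* suc q) (l ℕ.* suc q)
    ≡⟨ sym (harmonic-+ (i ℕ.* suc q) (suc q) (l ℕ.* suc q)) ⟩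
  harmonic (i ℕ.* suc q) (suc l ℕ.* suc q) ∎
  where
  open ℚ.≤-Reasoning
  block : 1/1+ i ℚ.≤ harmonic (i ℕ.* suc q) (suc q)
  block = subst (ℚ._≤ harmonic (i ℕ.* suc q) (suc q)) (times-cancel q i)
    (times≤harmonic (i ℕ.* suc q) (suc q) (q ℕ.+ i ℕ.* suc q)
      (ℕ.≤-reflexive (ℕ.+-comm (i ℕ.* suc q) (suc q))))

refine-upper : ∀ i l q → harmonic (suc i ℕ.* suc q) (l ℕ.* suc q) ℚ.≤ harmonic i l
refine-upper i zero    q = ℚ.≤-refl
refine-upper i (suc l) q = begin
  harmonic (suc i ℕ.* suc q) (suc l ℕ.* suc q)
    ≡⟨ harmonic-+ (suc i ℕ.* suc q) (suc q) (l ℕ.* suc q) ⟩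
  harmonic (suc i ℕ.* suc q) (suc q) ℚ.+ harmonic (suc (suc i) ℕ.* suc q) (l ℕ.* suc q)
    ≤⟨ ℚ.+-mono-≤ block (refine-upper (suc i) l q) ⟩
  1/1+ i ℚ.+ harmonic (suc i) l ∎
  where
  open ℚ.≤-Reasoning
  block : harmonic (suc i ℕ.* suc q) (suc q) ℚ.≤ 1/1+ i
  block = subst (harmonic (suc i ℕ.* suc q) (suc q) ℚ.≤_) (times-cancel q i)
    (harmonic≤times (suc i ℕ.* suc q) (suc q) (q ℕ.+ i ℕ.* suc q) (ℕ.n≤1+n _))

logSum-≤ : ∀ m p q → logSum m (suc p) ℚ.≤ 1/1+ q ℚ.+ logSum m (suc q)
logSum-≤ m p q = begin
  harmonic (suc p) (k ℕ.* suc p)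
    ≤⟨ refine-lower (suc p) (k ℕ.* suc p) q ⟩
  harmonic (suc p ℕ.* suc q) (k ℕ.* suc p ℕ.* suc q)
    ≡⟨ cong₂ harmonic (ℕ.*-comm (suc p) (suc q)) swap ⟩
  harmonic (suc q ℕ.* suc p) (k ℕ.* suc q ℕ.* suc p)
    ≤⟨ refine-upper q (k ℕ.* suc q) p ⟩
  harmonic q (k ℕ.* suc q)
    ≤⟨ harmonic-step q (k ℕ.* suc q) ⟩
  1/1+ q ℚ.+ harmonic (suc q) (k ℕ.* suc q) ∎
  where
  open ℚ.≤-Reasoning
  k : ℕ
  k = m ℕ.∸ 1
  swap : k ℕ.* suc p ℕ.* suc q ≡ k ℕ.* suc q ℕ.* suc p
  swap = trans (ℕ.*-assoc k (suc p) (suc q))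
    (trans (cong (k ℕ.*_) (ℕ.*-comm (suc p) (suc q)))
           (sym (ℕ.*-assoc k (suc q) (suc p))))

logSum-diff : ∀ m p q →
  logSum m (suc p) ℚ.- logSum m (suc q) ℚ.≤ 1/1+ p ℚ.+ 1/1+ q
logSum-diff m p q = begin
  logSum m (suc p) ℚ.- x
    ≤⟨ ℚ.+-monoˡ-≤ (ℚ.- x) (logSum-≤ m p q) ⟩
  1/1+ q ℚ.+ x ℚ.- x
    ≡⟨ ℚ.+-assoc (1/1+ q) x (ℚ.- x) ⟩
  1/1+ q ℚ.+ (x ℚ.- x)
    ≡⟨ cong (1/1+ q ℚ.+_) (ℚ.+-inverseʳ x) ⟩
  1/1+ q ℚ.+ 0ℚ
    ≤⟨ ℚ.+-monoʳ-≤ (1/1+ q) (0≤1/1+ p) ⟩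
  1/1+ q ℚ.+ 1/1+ p
    ≡⟨ ℚ.+-comm (1/1+ q) (1/1+ p) ⟩
  1/1+ p ℚ.+ 1/1+ q ∎
  where
  open ℚ.≤-Reasoning
  x : ℚ
  x = logSum m (suc q)

neg-diff : ∀ x y → ℚ.- (x ℚ.- y) ≡ y ℚ.- x
neg-diff x y = trans (ℚ.neg-distrib-+ x (ℚ.- y))
  (trans (cong (ℚ.- x ℚ.+_) (ℚ-Group.⁻¹-involutive y)) (ℚ.+-comm (ℚ.- x) y))

logSum-regular : ∀ m p q →
  ℚ.∣ logSum m (suc p) ℚ.- logSum m (suc q) ∣ ℚ.≤ 1/1+ p ℚ.+ 1/1+ q
logSum-regular m p q
  with ℚ.∣p∣≡p∨∣p∣≡-p (logSum m (suc p) ℚ.- logSum m (suc q))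
... | inj₁ eq = subst (ℚ._≤ 1/1+ p ℚ.+ 1/1+ q) (sym eq) (logSum-diff m p q)
... | inj₂ eq = subst (ℚ._≤ 1/1+ p ℚ.+ 1/1+ q)
  (sym (trans eq (neg-diff (logSum m (suc p)) (logSum m (suc q)))))
  (subst (logSum m (suc q) ℚ.- logSum m (suc p) ℚ.≤_)
    (ℚ.+-comm (1/1+ q) (1/1+ p)) (logSum-diff m q p))

-- The natural logarithm of m, as ∫₁ᵐ dt/t.
log : (m : ℕ) → .{{NonZero m}} → ℝ
log m = record
  { seq     = λ n → logSum m (suc n)
  ; regular = logSum-regular m
  }

record LCM (S : ℕ → Set) : Set where
  field
    value          : ℕ
    {{nonZero}}    : NonZero value
    commonMultiple : ∀ {n} → S n → n ∣ value
    least          : ∀ {m} → (∀ {n} → S n → n ∣ m) → value ∣ m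

LCM-unique : ∀ {S} (ℓ ℓ′ : LCM S) → LCM.value ℓ ≡ LCM.value ℓ′
LCM-unique ℓ ℓ′ = ∣-antisym
  (LCM.least ℓ (LCM.commonMultiple ℓ′)) (LCM.least ℓ′ (LCM.commonMultiple ℓ))

-- Classically the LCM of a finite set of positive integers always exists;
-- constructively, computing it amounts to deciding membership, so only the
-- double negation is available for an arbitrary predicate.
LCM-exists : ∀ (S : ℕ → Set) N → (∀ {n} → S n → 0 ℕ.< n × n ℕ.≤ N) → ¬ ¬ LCM S
LCM-exists S zero bd k = k (record
  { value          = 1
  ; commonMultiple = λ s → ⊥-elim (absurd (bd s))
  ; least          = λ _ → 1∣ _
  })
  where
  absurd : ∀ {n} → ¬ (0 ℕ.< n × n ℕ.≤ 0)
  absurd (s≤s _ , ())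
LCM-exists S (suc N) bd k =
  LCM-exists S′ N (λ { (s , n≤N) → proj₁ (bd s) , n≤N }) λ ℓ →
  ¬¬-excluded-middle λ d → k (extend ℓ d)
  where
  S′ : ℕ → Set
  S′ n = S n × n ℕ.≤ N

  split : ∀ {n} → S n → n ℕ.≤ N ⊎ n ≡ suc N
  split s with ℕ.m≤n⇒m<n∨m≡n (proj₂ (bd s))
  ... | inj₁ lt = inj₁ (ℕ.≤-pred lt)
  ... | inj₂ eq = inj₂ eq

  extend : LCM S′ → Dec (S (suc N)) → LCM S
  extend ℓ (yes sN) = record
    { value          = lcm v (suc N)
    ; nonZero        = ℕ.≢-nonZero λ eq → ℕ.≢-nonZero⁻¹ (v ℕ.* suc N)
                         {{ℕ.m*n≢0 v (suc N)}}
                         (0∣⇒≡0 (subst (_∣ v ℕ.* suc N) eq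
                           (lcm-least {v} (m∣m*n (suc N)) (n∣m*n v))))
    ; commonMultiple = common
    ; least          = λ cm → lcm-least (LCM.least ℓ (λ { (s , _) → cm s })) (cm sN)
    }
    where
    v : ℕ
    v = LCM.value ℓ
    instance
      v≢0 : NonZero v
      v≢0 = LCM.nonZero ℓ
    common : ∀ {n} → S n → n ∣ lcm v (suc N)
    common s with split s
    ... | inj₁ n≤N  = ∣-trans (LCM.commonMultiple ℓ (s , n≤N)) (m∣lcm[m,n] v (suc N))
    ... | inj₂ refl = n∣lcm[m,n] v (suc N)
  extend ℓ (no ¬sN) = record
    { value          = LCM.value ℓ
    ; nonZero        = LCM.nonZero ℓ
    ; commonMultiple = common
    ; least          = λ cm → LCM.least ℓ (λ { (s , _) → cm s })
    }
    where
    common : ∀ {n} → S n → n ∣ LCM.value ℓ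
    common s with split s
    ... | inj₁ n≤N  = LCM.commonMultiple ℓ (s , n≤N)
    ... | inj₂ refl = ⊥-elim (¬sN s)

PositiveValuesUpTo : ℤ[x,y] → ℕ → ℕ → Set
PositiveValuesUpTo F N n = (0 ℕ.< n × n ℕ.≤ N) × Represents F (+ n)

-- The LCM of the values is an argument because it is unique (LCM-unique)
-- and classically exists (LCM-exists), but representability by F is not
-- decidable by definition.
ψ : (F : ℤ[x,y]) (N : ℕ) → LCM (PositiveValuesUpTo F N) → ℝ
ψ F N ℓ = log (LCM.value ℓ) {{LCM.nonZero ℓ}}

{-# OPTIONS --safe #-}

-- Lower bound: if M is a common multiple of the progression u, u + a, …, u + m a,
-- then the product of these terms divides M aᵐ m!.  This follows by induction on m
-- (it is the partial fraction expansion of 1 / ∏ (u + i a)) and needs no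
-- coprimality of a and u.  For u ≥ k a and m = k the product is at least
-- 2ᵏ aᵏ k!, so M ≥ 2ᵏ, and k can be taken proportional to N.
--
-- Upper bound: the same divisibility with a = 1 shows that if M is a common
-- multiple of 1, …, m then C(2m, m) M is one of 1, …, 2m.  Iterating this from
-- m = 1 gives a common multiple of 1, …, N below 2 to the power 4N.
--
-- The logarithm enters only through ½ ≤ Σ_{a < j ≤ 2a} 1/j ≤ 1, which gives
-- k/2 ≤ log 2ᵏ ≤ k for the Riemann sums.
module Submission where

open import Data.Nat.Base as ℕ using (ℕ; zero; suc; _≤_; _<_; _≥_; z≤n; s≤s; NonZero; _^_; _!)
import Data.Nat.Properties as ℕ
open import Data.Nat.Combinatorics using (_C_; nCk≡n!/k![n-k]!; k![n∸k]!∣n!; nCk+nC[k+1]≡[n+1]C[k+1])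
open import Data.Nat.Divisibility
import Data.Nat.DivMod as ℕ
open import Data.Nat.Tactic.RingSolver using (solve-∀)
open import Data.Integer.Base as ℤ using (ℤ; +_; -[1+_]; 0ℤ; 1ℤ; -1ℤ)
import Data.Integer.Properties as ℤ
import Data.Integer.DivMod as ℤ
import Data.Integer.Tactic.RingSolver as ℤ-Ring
open import Data.Rational.Base as ℚ using (ℚ; 0ℚ; _/_; toℚᵘ)
import Data.Rational.Properties as ℚ
import Data.Rational.Unnormalised.Base as ℚᵘ
import Data.Rational.Unnormalised.Properties as ℚᵘ
open import Data.Product.Base using (_×_; _,_; ∃-syntax)
open import Data.Sum.Base using (inj₁; inj₂)
open import Function.Base using (it)
open import Relation.Binary.PropositionalEquality
open import Relation.Nullary using (yes; no)
open import Defs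

-- Divisibility and size of products over arithmetic progressions.

module _ where
  open import Data.Nat.Base using (_+_; _*_; _∸_)

  apProd : (a u m : ℕ) → ℕ
  apProd a u zero    = 1
  apProd a u (suc m) = u * apProd a (a + u) m

  -- The recursion of `apProd` peels off the smallest factor. Peeling off the largest as well is
  -- what lets `apProd∣` compare the two subproducts that each omit one extreme term.
  apProd-last : ∀ a u m → apProd a u (suc m) ≡ apProd a u m * (m * a + u)
  apProd-last a u zero    = ℕ.*-comm u 1
  apProd-last a u (suc m) = begin
    u * apProd a (a + u) (suc m)                 ≡⟨ cong (u *_) (apProd-last a (a + u) m) ⟩
    u * (apProd a (a + u) m * (m * a + (a + u))) ≡⟨ ℕ.*-assoc u _ _ ⟨
    apProd a u (suc m) * (m * a + (a + u))       ≡⟨ cong (apProd a u (suc m) *_) (shift m a u) ⟩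
    apProd a u (suc m) * (suc m * a + u)         ∎
    where
    open ≡-Reasoning
    shift : ∀ m a u → m * a + (a + u) ≡ suc m * a + u
    shift = solve-∀

  -- The product of m + 2 terms divides both w X and u X, where X is the bound
  -- for m + 1 terms and u, w are the extreme terms; and w - u = (m + 1) a.
  apProd∣ : ∀ a u m M → (∀ i → i ≤ m → i * a + u ∣ M) →
            apProd a u (suc m) ∣ M * a ^ m * m !
  apProd∣ a u zero    M u∣M =
    subst₂ _∣_ (sym (ℕ.*-identityʳ u)) (sym (trans (ℕ.*-identityʳ (M * 1)) (ℕ.*-identityʳ M)))
      (u∣M 0 z≤n)
  apProd∣ a u (suc m) M u∣M =
    subst (apProd a u (suc (suc m)) ∣_) (collect M (a ^ m) (m !) a m)
      (∣m+n∣m⇒∣n (subst (apProd a u (suc (suc m)) ∣_) (split X m a u) ∣wX) ∣uX)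
    where
    X w : ℕ
    X = M * a ^ m * m !
    w = m * a + (a + u)
    shift : ∀ i a u → suc i * a + u ≡ i * a + (a + u)
    shift = solve-∀
    split : ∀ X m a u → X * (m * a + (a + u)) ≡ u * X + X * (suc m * a)
    split = solve-∀
    collect : ∀ M p f a m → M * p * f * (suc m * a) ≡ M * (a * p) * (suc m * f)
    collect = solve-∀
    ∣wX : apProd a u (suc (suc m)) ∣ X * w
    ∣wX = subst (_∣ X * w)
      (trans (ℕ.*-assoc u _ w) (cong (u *_) (sym (apProd-last a (a + u) m))))
      (*-monoˡ-∣ w (apProd∣ a u m M λ i i≤m → u∣M i (ℕ.m≤n⇒m≤1+n i≤m)))
    ∣uX : apProd a u (suc (suc m)) ∣ u * X
    ∣uX = *-monoʳ-∣ u (apProd∣ a (a + u) m M λ i i≤m →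
      subst (_∣ M) (shift i a u) (u∣M (suc i) (s≤s i≤m)))

  -- For 1 ≤ i ≤ m the factor i a + u is at least 2 i a, since i a ≤ k a ≤ u.
  ≤apProd : ∀ a u k m → k * a ≤ u → m ≤ k → 2 ^ m * a ^ m * m ! ≤ apProd a (a + u) m
  ≤apProd a u k zero    ka≤u m<k = ℕ.≤-refl
  ≤apProd a u k (suc m) ka≤u m<k = begin
    2 ^ suc m * a ^ suc m * suc m !                        ≡⟨ collect a (2 ^ m) (a ^ m) m (m !) ⟩
    2 ^ m * a ^ m * m ! * (m * a + (a + suc m * a))
      ≤⟨ ℕ.*-mono-≤ (≤apProd a u k m ka≤u (ℕ.<⇒≤ m<k))
           (ℕ.+-monoʳ-≤ (m * a) (ℕ.+-monoʳ-≤ a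
             (ℕ.≤-trans (ℕ.*-monoˡ-≤ a m<k) ka≤u))) ⟩
    apProd a (a + u) m * (m * a + (a + u))           ≡⟨ apProd-last a (a + u) m ⟨
    apProd a (a + u) (suc m)                         ∎
    where
    open ℕ.≤-Reasoning
    collect : ∀ a p q m f → 2 * p * (a * q) * (suc m * f) ≡ p * q * f * (m * a + (a + suc m * a))
    collect = solve-∀

  2^k≤commonMultiple : ∀ a u k M .{{_ : NonZero a}} .{{_ : NonZero u}} .{{_ : NonZero M}} →
    k * a ≤ u → (∀ i → i ≤ k → i * a + u ∣ M) → 2 ^ k ≤ M
  2^k≤commonMultiple a u k M ka≤u u∣M =
    ℕ.*-cancelʳ-≤ (2 ^ k) M (a ^ k * k !) (begin
      2 ^ k * (a ^ k * k !)        ≡⟨ ℕ.*-assoc (2 ^ k) _ _ ⟨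
      2 ^ k * a ^ k * k !          ≤⟨ ≤apProd a u k k ka≤u ℕ.≤-refl ⟩
      -- The first factor u is only used as u ≥ 1; the other k factors supply 2ᵏ.
      apProd a (a + u) k           ≤⟨ ℕ.m≤n*m _ u ⟩
      apProd a u (suc k)           ≤⟨ ∣⇒≤ {{ℕ.m*n≢0 _ _ {{ℕ.m*n≢0 M _}}}} (apProd∣ a u k M u∣M) ⟩
      M * a ^ k * k !              ≡⟨ ℕ.*-assoc M _ _ ⟩
      M * (a ^ k * k !)            ∎)
    where
    open ℕ.≤-Reasoning
    instance
      a^k≢0 : NonZero (a ^ k)
      a^k≢0 = ℕ.m^n≢0 a k
      k!≢0 : NonZero (k !)
      k!≢0 = k ℕ.!≢0
      a^k*k!≢0 : NonZero (a ^ k * k !)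
      a^k*k!≢0 = ℕ.m*n≢0 (a ^ k) (k !)

  -- Small common multiples of 1, ..., N.

  apProd-factorial : ∀ r m → r ! * apProd 1 (suc r) m ≡ (r + m) !
  apProd-factorial r zero    = trans (ℕ.*-identityʳ (r !)) (cong _! (sym (ℕ.+-identityʳ r)))
  apProd-factorial r (suc m) = begin
    r ! * (suc r * apProd 1 (suc (suc r)) m) ≡⟨ ℕ.*-assoc (r !) _ _ ⟨
    r ! * suc r * apProd 1 (suc (suc r)) m   ≡⟨ cong (_* apProd 1 (suc (suc r)) m) (ℕ.*-comm (r !) (suc r)) ⟩
    suc r ! * apProd 1 (suc (suc r)) m       ≡⟨ apProd-factorial (suc r) m ⟩
    (suc r + m) !                            ≡⟨ cong _! (ℕ.+-suc r m) ⟨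
    (r + suc m) !                            ∎
    where open ≡-Reasoning

  CommonMultiple : ℕ → ℕ → Set
  CommonMultiple n M = ∀ i → i < n → suc i ∣ M

  -- Apply `apProd∣` with difference 1 to r + 1, ..., r + s + 1, then multiply by r! to complete the
  -- product to a factorial.
  factorial∣commonMultiple : ∀ r s {M} → CommonMultiple (r + suc s) M →
                             (r + suc s) ! ∣ r ! * (M * s !)
  factorial∣commonMultiple r s {M} cm = subst₂ _∣_ (apProd-factorial r (suc s))
    (cong (r ! *_) (trans (cong (λ x → M * x * s !) (ℕ.^-zeroˡ s)) (cong (_* s !) (ℕ.*-identityʳ M))))
    (*-monoʳ-∣ (r !) (apProd∣ 1 (suc r) s M λ i i≤s →
      subst (_∣ M) (trans (cong suc (ℕ.+-comm r i))
          (trans (sym (ℕ.+-suc i r)) (cong (_+ suc r) (sym (ℕ.*-identityʳ i)))))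
        (cm (r + i) (ℕ.+-monoʳ-< r (s≤s i≤s)))))

  factorial*factorial∣ : ∀ m n → m ! * n ! ∣ (m + n) !
  factorial*factorial∣ m n = subst (λ x → m ! * x ! ∣ (m + n) !) (ℕ.m+n∸m≡n m n)
    (k![n∸k]!∣n! (ℕ.m≤m+n m n))

  centralBinomial : ∀ m → ((m + m) C m) * (m ! * m !) ≡ (m + m) !
  centralBinomial m = begin
    ((m + m) C m) * (m ! * m !)           ≡⟨ cong (λ x → ((m + m) C m) * (m ! * x !)) (ℕ.m+n∸m≡n m m) ⟨
    ((m + m) C m) * (m ! * (m + m ∸ m) !) ≡⟨ cong (_* (m ! * (m + m ∸ m) !)) (nCk≡n!/k![n-k]! m≤m+m) ⟩
    _                                     ≡⟨ ℕ.m/n*n≡m {{m ℕ.!* (m + m ∸ m) !≢0}} (k![n∸k]!∣n! m≤m+m) ⟩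
    (m + m) !                             ∎
    where
    open ≡-Reasoning
    m≤m+m : m ≤ m + m
    m≤m+m = ℕ.m≤m+n m m

  C≤2^ : ∀ n k → n C k ≤ 2 ^ n
  C≤2^ zero    zero    = ℕ.≤-refl
  C≤2^ zero    (suc k) = z≤n
  C≤2^ (suc n) zero    = ℕ.m^n>0 2 (suc n)
  C≤2^ (suc n) (suc k) = begin
    suc n C suc k         ≡⟨ nCk+nC[k+1]≡[n+1]C[k+1] n k ⟨
    n C k + n C suc k     ≤⟨ ℕ.+-mono-≤ (C≤2^ n k) (C≤2^ n (suc k)) ⟩
    2 ^ n + 2 ^ n         ≡⟨ cong (λ x → 2 ^ n + x) (ℕ.+-identityʳ (2 ^ n)) ⟨
    2 ^ suc n             ∎
    where open ℕ.≤-Reasoning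

  -- With j = m + r + 1 the factorial (2m)! is divisible by j m! r! s!, and
  -- m! divides M r! s!.
  ∣centralBinomial : ∀ r s {M} → let m = r + suc s in CommonMultiple m M →
                     suc (m + r) ∣ ((m + m) C m) * M
  ∣centralBinomial r s {M} cm = *-cancelʳ-∣ (m ! * m !) {{m ℕ.!* m !≢0}} (begin
    j * (m ! * m !)                  ≡⟨ rearr₁ j (m !) ⟩
    j * m ! * m !                    ∣⟨ *-monoʳ-∣ (j * m !) (factorial∣commonMultiple r s cm) ⟩
    j * m ! * (r ! * (M * s !))      ≡⟨ rearr₂ j (m !) (r !) M (s !) ⟩
    j * (m ! * r !) * s ! * M        ∣⟨ *-monoˡ-∣ M (*-monoˡ-∣ (s !) (*-monoʳ-∣ j (factorial*factorial∣ m r))) ⟩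
    j ! * s ! * M                    ∣⟨ *-monoˡ-∣ M (factorial*factorial∣ j s) ⟩
    (j + s) ! * M                    ≡⟨ cong (λ x → x ! * M) (j+s r s) ⟩
    (m + m) ! * M                    ≡⟨ cong (_* M) (centralBinomial m) ⟨
    ((m + m) C m) * (m ! * m !) * M  ≡⟨ rearr₃ ((m + m) C m) (m ! * m !) M ⟩
    ((m + m) C m) * M * (m ! * m !)  ∎)
    where
    open ∣-Reasoning
    m j : ℕ
    m = r + suc s
    j = suc (m + r)
    rearr₁ : ∀ j x → j * (x * x) ≡ j * x * x
    rearr₁ = solve-∀
    rearr₂ : ∀ j x y M z → j * x * (y * (M * z)) ≡ j * (x * y) * z * M
    rearr₂ = solve-∀
    rearr₃ : ∀ c x M → c * x * M ≡ c * M * x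
    rearr₃ = solve-∀
    j+s : ∀ r s → suc (r + suc s + r) + s ≡ r + suc s + (r + suc s)
    j+s = solve-∀

  -- Numbers up to m already divide M. A larger one is m + r + 1 with r < m, and writing m = r + s +
  -- 1 makes `∣centralBinomial` applicable.
  commonMultiple-double : ∀ m {M} → CommonMultiple m M → CommonMultiple (m + m) (((m + m) C m) * M)
  commonMultiple-double m {M} cm i i<m+m with i ℕ.<? m
  ... | yes i<m = ∣n⇒∣m*n ((m + m) C m) (cm i i<m)
  ... | no  i≮m with ℕ.m≤n⇒∃[o]m+o≡n (ℕ.≮⇒≥ i≮m)
  ...   | r , refl with ℕ.m≤n⇒∃[o]m+o≡n (ℕ.+-cancelˡ-< m r m i<m+m)
  ...     | s , refl = subst (λ m → suc (m + r) ∣ ((m + m) C m) * M) (ℕ.+-suc r s)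
              (∣centralBinomial r s (subst (λ m → CommonMultiple m M) (sym (ℕ.+-suc r s)) cm))

  -- With m = 2ᵏ, doubling costs a factor C(2m, m) ≤ 2²ᵐ, so the exponent grows from 2m to 4m and
  -- stays twice the range covered.
  boundedCommonMultiple : ∀ k → ∃[ M ] (M ≢ 0 × CommonMultiple (2 ^ k) M × M ≤ 2 ^ (2 * 2 ^ k))
  boundedCommonMultiple zero    = 1 , (λ ()) , (λ { zero _ → ∣-refl ; (suc _) (s≤s ()) }) , s≤s z≤n
  boundedCommonMultiple (suc k) with boundedCommonMultiple k
  ... | M , M≢0 , cm , M≤ =
    c * M , ℕ.≢-nonZero⁻¹ _ {{ℕ.m*n≢0 c M}} ,
    subst (λ n → CommonMultiple n (c * M)) (cong (λ x → m + x) (sym (ℕ.+-identityʳ m))) (commonMultiple-double m cm) ,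
    (begin
      c * M                         ≤⟨ ℕ.*-mono-≤ (C≤2^ (m + m) m) M≤ ⟩
      2 ^ (m + m) * 2 ^ (2 * m)     ≡⟨ ℕ.^-distribˡ-+-* 2 (m + m) (2 * m) ⟨
      2 ^ (m + m + 2 * m)           ≡⟨ cong (2 ^_) (collect m) ⟩
      2 ^ (2 * (2 * m))             ∎)
    where
    open ℕ.≤-Reasoning
    m c : ℕ
    m = 2 ^ k
    c = (m + m) C m
    collect : ∀ m → m + m + 2 * m ≡ 2 * (2 * m)
    collect = solve-∀
    instance
      M≢0′ : NonZero M
      M≢0′ = ℕ.≢-nonZero M≢0
      c≢0 : NonZero c
      c≢0 = ℕ.m*n≢0⇒m≢0 c {{subst NonZero (sym (centralBinomial m)) ((m + m) ℕ.!≢0)}}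

  powerOfTwo-between : ∀ n → ∃[ k ] (suc n ≤ 2 ^ k × 2 ^ k ≤ 2 * suc n)
  powerOfTwo-between zero = 0 , s≤s z≤n , s≤s z≤n
  powerOfTwo-between (suc n) with powerOfTwo-between n
  ... | k , n< , ≤2n with ℕ.m≤n⇒m<n∨m≡n n<
  ...   | inj₁ n+1< = k , n+1< , ℕ.≤-trans ≤2n (ℕ.*-monoʳ-≤ 2 (ℕ.n≤1+n (suc n)))
  -- Here `suc n` is exactly 2ᵏ, so the next number needs the next power.
  ...   | inj₂ eq = suc k , subst (λ x → suc (suc n) ≤ 2 * x) eq (s≤s (ℕ.≤-trans (ℕ.m≤n+m (suc n) n) (ℕ.+-monoʳ-≤ n (ℕ.m≤m+n (suc n) 0)))) ,
                    subst (λ x → 2 * x ≤ 2 * suc (suc n)) eq (ℕ.*-monoʳ-≤ 2 (ℕ.n≤1+n (suc n)))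

  -- Rounding N up to a power of two at most doubles it, which turns the exponent 2 · 2ᵏ into at
  -- most 4N.
  smallCommonMultiple : ∀ N .{{_ : NonZero N}} → ∃[ M ] (M ≢ 0 × CommonMultiple N M × M ≤ 2 ^ (4 * N))
  smallCommonMultiple N@(suc n) with powerOfTwo-between n
  ... | k , N≤2^k , 2^k≤2N with boundedCommonMultiple k
  ...   | M , M≢0 , cm , M≤ =
    M , M≢0 , (λ i i<N → cm i (ℕ.≤-trans i<N N≤2^k)) ,
    ℕ.≤-trans M≤ (ℕ.^-monoʳ-≤ 2 (subst (2 * 2 ^ k ≤_) (sym (ℕ.*-assoc 2 2 N)) (ℕ.*-monoʳ-≤ 2 2^k≤2N)))

open import Data.Integer.Base using (_+_; _*_)

-- Riemann sums for the logarithm of a power of two.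

harmonic-mono : ∀ a {l k} → l ≤ k → harmonic a l ℚ.≤ harmonic a k
harmonic-mono a {k = zero}  z≤n       = ℚ.≤-refl
harmonic-mono a {k = suc k} z≤n       = ℚ.≤-trans (harmonic-mono a {k = k} z≤n) (harmonic-step a k)
harmonic-mono a             (s≤s l≤k) = ℚ.+-monoʳ-≤ (1/1+ a) (harmonic-mono (suc a) l≤k)

logSum-mono : ∀ n {l m} → l ≤ m → logSum l n ℚ.≤ logSum m n
logSum-mono n l≤m = harmonic-mono n (ℕ.*-monoˡ-≤ n (ℕ.∸-monoˡ-≤ 1 l≤m))

-- The analogue of log 2m = log 2 + log m: the range from n to 2mn is cut at mn, and the upper piece
-- is a block from a to 2a.
logSum-double : ∀ m n .{{_ : NonZero m}} →
  logSum (2 ℕ.* m) n ≡ harmonic (m ℕ.* n) (m ℕ.* n) ℚ.+ logSum m n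
logSum-double (suc m) n = begin
  harmonic n ((m ℕ.+ suc (m ℕ.+ 0)) ℕ.* n)
    ≡⟨ cong (harmonic n) (split m n) ⟩
  harmonic n (m ℕ.* n ℕ.+ suc m ℕ.* n)
    ≡⟨ harmonic-+ n (m ℕ.* n) (suc m ℕ.* n) ⟩
  harmonic n (m ℕ.* n) ℚ.+ harmonic (m ℕ.* n ℕ.+ n) (suc m ℕ.* n)
    ≡⟨ ℚ.+-comm (harmonic n (m ℕ.* n)) _ ⟩
  harmonic (m ℕ.* n ℕ.+ n) (suc m ℕ.* n) ℚ.+ harmonic n (m ℕ.* n)
    ≡⟨ cong (λ a → harmonic a (suc m ℕ.* n) ℚ.+ harmonic n (m ℕ.* n)) (ℕ.+-comm (m ℕ.* n) n) ⟩
  harmonic (suc m ℕ.* n) (suc m ℕ.* n) ℚ.+ harmonic n (m ℕ.* n) ∎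
  where
  open ≡-Reasoning
  split : ∀ m n → (m ℕ.+ suc (m ℕ.+ 0)) ℕ.* n ≡ m ℕ.* n ℕ.+ suc m ℕ.* n
  split = solve-∀

-- Each of the a terms is at least the last one, 1/(2a). The index 2a - 1 is written in the shape
-- that `times-cancel` expects.
½≤harmonic : ∀ a .{{_ : NonZero a}} → 1/1+ 1 ℚ.≤ harmonic a a
½≤harmonic (suc q) = subst (ℚ._≤ harmonic (suc q) (suc q)) (times-cancel q 1)
  (times≤harmonic (suc q) (suc q) (q ℕ.+ 1 ℕ.* suc q)
    (ℕ.≤-reflexive (cong (suc q ℕ.+_) (sym (ℕ.*-identityˡ (suc q))))))

harmonic≤1 : ∀ a .{{_ : NonZero a}} → harmonic a a ℚ.≤ 1/1+ 0
harmonic≤1 (suc q) = subst (harmonic (suc q) (suc q) ℚ.≤_) (times-cancel q 0)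
  (harmonic≤times (suc q) (suc q) (q ℕ.+ 0) (ℕ.m≤n⇒m≤1+n (ℕ.≤-reflexive (ℕ.+-identityʳ q))))

times≤logSum-2^ : ∀ k n .{{_ : NonZero n}} → times k (1/1+ 1) ℚ.≤ logSum (2 ^ k) n
times≤logSum-2^ zero    n = ℚ.≤-refl
times≤logSum-2^ (suc k) n = subst (times (suc k) (1/1+ 1) ℚ.≤_) (sym (logSum-double (2 ^ k) n {{ℕ.m^n≢0 2 k}}))
  (ℚ.+-mono-≤ (½≤harmonic (2 ^ k ℕ.* n) {{ℕ.m*n≢0 (2 ^ k) n {{ℕ.m^n≢0 2 k}}}}) (times≤logSum-2^ k n))

logSum-2^≤times : ∀ k n .{{_ : NonZero n}} → logSum (2 ^ k) n ℚ.≤ times k (1/1+ 0)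
logSum-2^≤times zero    n = ℚ.≤-refl
logSum-2^≤times (suc k) n = subst (ℚ._≤ times (suc k) (1/1+ 0)) (sym (logSum-double (2 ^ k) n {{ℕ.m^n≢0 2 k}}))
  (ℚ.+-mono-≤ (harmonic≤1 (2 ^ k ℕ.* n) {{ℕ.m*n≢0 (2 ^ k) n {{ℕ.m^n≢0 2 k}}}}) (logSum-2^≤times k n))

-- From rational estimates to inequalities between reals.

toℚᵘ-*-integer : ∀ p q N → toℚᵘ ((+ p / suc q) ℚ.* (+ N / 1)) ℚᵘ.≃ ℚᵘ.mkℚᵘ (+ (p ℕ.* N)) q
toℚᵘ-*-integer p q N = begin
  toℚᵘ ((+ p / suc q) ℚ.* (+ N / 1))
    ≈⟨ ℚ.toℚᵘ-homo-* (+ p / suc q) (+ N / 1) ⟩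
  toℚᵘ (+ p / suc q) ℚᵘ.* toℚᵘ (+ N / 1)
    ≈⟨ ℚᵘ.*-cong (ℚ.toℚᵘ-fromℚᵘ (ℚᵘ.mkℚᵘ (+ p) q)) (ℚ.toℚᵘ-fromℚᵘ (ℚᵘ.mkℚᵘ (+ N) 0)) ⟩
  ℚᵘ.mkℚᵘ (+ p) q ℚᵘ.* ℚᵘ.mkℚᵘ (+ N) 0
    ≈⟨ ℚᵘ.*≡* (cong₂ ℤ._*_ (sym (ℤ.pos-* p N)) (cong +_ (sym (ℕ.*-identityʳ (suc q))))) ⟩
  ℚᵘ.mkℚᵘ (+ (p ℕ.* N)) q ∎
  where open import Relation.Binary.Reasoning.Setoid ℚᵘ.≃-setoid

-- In unnormalised fractions both sides have explicit numerators and denominators, so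
-- cross-multiplication leaves an inequality of naturals.
*-integer≤times : ∀ p q N k d → p ℕ.* N ℕ.* suc d ≤ k ℕ.* suc q →
  (+ p / suc q) ℚ.* (+ N / 1) ℚ.≤ times k (1/1+ d)
*-integer≤times p q N k d le = ℚ.toℚᵘ-cancel-≤ (begin
  toℚᵘ ((+ p / suc q) ℚ.* (+ N / 1)) ≃⟨ toℚᵘ-*-integer p q N ⟩
  ℚᵘ.mkℚᵘ (+ (p ℕ.* N)) q            ≤⟨ ℚᵘ.*≤* (subst₂ ℤ._≤_ (ℤ.pos-* (p ℕ.* N) (suc d)) (ℤ.pos-* k (suc q)) (ℤ.+≤+ le)) ⟩
  ℚᵘ.mkℚᵘ (+ k) d                    ≃⟨ times-1/1+ k d ⟨
  toℚᵘ (times k (1/1+ d))            ∎)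
  where open ℚᵘ.≤-Reasoning

times≤*-integer : ∀ p N → times (p ℕ.* N) (1/1+ 0) ℚ.≤ (+ p / 1) ℚ.* (+ N / 1)
times≤*-integer p N = ℚ.≤-reflexive (ℚ.toℚᵘ-injective
  (ℚᵘ.≃-trans (times-1/1+ (p ℕ.* N) 0) (ℚᵘ.≃-sym (toℚᵘ-*-integer p 0 N))))

p≤p+slack : ∀ p n → p ℚ.≤ p ℚ.+ (1/1+ n ℚ.+ 1/1+ n)
p≤p+slack p n = subst (ℚ._≤ p ℚ.+ (1/1+ n ℚ.+ 1/1+ n)) (ℚ.+-identityʳ p)
  (ℚ.+-monoʳ-≤ p (ℚ.+-mono-≤ (0≤1/1+ n) (0≤1/1+ n)))

0<1/1+ : ∀ n → 0ℚ ℚ.< 1/1+ n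
0<1/1+ n = ℚ.positive⁻¹ (1/1+ n) {{ℚ.normalize-pos 1 (suc n)}}

-- The chain is N/(q + 1) ≤ k/2 ≤ log 2ᵏ ≤ log m, valid at every index of the approximating
-- sequences.
2^k≤⇒≤log : ∀ {k m} .{{_ : NonZero m}} q N → 2 ^ k ≤ m → N ℕ.* 2 ≤ k ℕ.* suc q →
  fromℚ ((1/1+ q) ℚ.* (+ N / 1)) ≤ℝ log m
2^k≤⇒≤log {k} {m} q N 2^k≤m le n = begin
  (1/1+ q) ℚ.* (+ N / 1)   ≤⟨ *-integer≤times 1 q N k 1 (subst (λ x → x ℕ.* 2 ≤ k ℕ.* suc q) (sym (ℕ.*-identityˡ N)) le) ⟩
  times k (1/1+ 1)         ≤⟨ times≤logSum-2^ k (suc n) ⟩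
  logSum (2 ^ k) (suc n)   ≤⟨ logSum-mono (suc n) 2^k≤m ⟩
  logSum m (suc n)         ≤⟨ p≤p+slack _ n ⟩
  logSum m (suc n) ℚ.+ (1/1+ n ℚ.+ 1/1+ n) ∎
  where open ℚ.≤-Reasoning

≤2^⇒log≤ : ∀ {m} .{{_ : NonZero m}} p N → m ≤ 2 ^ (p ℕ.* N) →
  log m ≤ℝ fromℚ ((+ p / 1) ℚ.* (+ N / 1))
≤2^⇒log≤ {m} p N m≤ n = begin
  logSum m (suc n)                ≤⟨ logSum-mono (suc n) m≤ ⟩
  logSum (2 ^ (p ℕ.* N)) (suc n)  ≤⟨ logSum-2^≤times (p ℕ.* N) (suc n) ⟩
  times (p ℕ.* N) (1/1+ 0)        ≤⟨ times≤*-integer p N ⟩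
  (+ p / 1) ℚ.* (+ N / 1)         ≤⟨ p≤p+slack _ n ⟩
  (+ p / 1) ℚ.* (+ N / 1) ℚ.+ (1/1+ n ℚ.+ 1/1+ n) ∎
  where open ℚ.≤-Reasoning

-- Reducing the progression and choosing its terms.

unit-multiple : ∀ A .{{_ : ℤ.NonZero A}} → ∃[ s ] (A * s ≡ + ℤ.∣ A ∣)
unit-multiple (+ suc a)  = 1ℤ , ℤ.*-identityʳ (+ suc a)
unit-multiple -[1+ a ]   = -1ℤ , trans (ℤ.*-comm -[1+ a ] -1ℤ) (ℤ.-1*i≡-i -[1+ a ])

progression-normalise : ∀ A B .{{_ : ℤ.NonZero A}} (i : ℕ) →
  ∃[ n ] (A * n + B ≡ + (i ℕ.* ℤ.∣ A ∣ ℕ.+ B ℤ.% A))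
progression-normalise A B i with unit-multiple A
-- The sign s of A turns the step A into its absolute value; subtracting the quotient q leaves only
-- the remainder of B.
... | s , A*s≡∣A∣ = + i * s ℤ.- q , (begin
  A * (+ i * s ℤ.- q) + B                     ≡⟨ cong (λ x → A * (+ i * s ℤ.- q) + x) (ℤ.a≡a%n+[a/n]*n B A) ⟩
  A * (+ i * s ℤ.- q) + (+ (B ℤ.% A) + q * A) ≡⟨ cancel A (+ i) s q (+ (B ℤ.% A)) ⟩
  + i * (A * s) + + (B ℤ.% A)                 ≡⟨ cong (λ x → + i * x + + (B ℤ.% A)) A*s≡∣A∣ ⟩
  + i * + ℤ.∣ A ∣ + + (B ℤ.% A)               ≡⟨ cong (_+ + (B ℤ.% A)) (ℤ.pos-* i ℤ.∣ A ∣) ⟨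
  + (i ℕ.* ℤ.∣ A ∣ ℕ.+ B ℤ.% A)               ∎)
  where
  open ≡-Reasoning
  q : ℤ
  q = B ℤ./ A
  cancel : ∀ A i s q r → A * (i * s ℤ.- q) + (r + q * A) ≡ i * (A * s) + r
  cancel = ℤ-Ring.solve-∀

-- Take k to be the integer part of N/(3a). The terms from ka + b to 2ka + b start high enough for
-- `2^k≤commonMultiple`, and they stay below 3ka ≤ N because b ≤ a ≤ ka.
2^k≤progressionMultiple : ∀ a b N M .{{_ : NonZero a}} .{{_ : NonZero M}} → b ≤ a → 3 ℕ.* a ≤ N →
  (∀ i → 0 < i ℕ.* a ℕ.+ b → i ℕ.* a ℕ.+ b ≤ N → i ℕ.* a ℕ.+ b ∣ M) →
  ∃[ k ] (2 ^ k ≤ M × N ℕ.* 2 ≤ k ℕ.* (12 ℕ.* a))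
2^k≤progressionMultiple a b N M b≤a 3a≤N ∣M = k ,
  2^k≤commonMultiple a (k ℕ.* a ℕ.+ b) k M {{it}} {{ka+b≢0}} (ℕ.m≤m+n (k ℕ.* a) b) term∣M ,
  (begin
    N ℕ.* 2                                    ≡⟨ cong (ℕ._* 2) (ℕ.m≡m%n+[m/n]*n N (3 ℕ.* a)) ⟩
    -- Since k ≥ 1, the remainder is at most 3a ≤ 3ka; hence N ≤ 6ka.
    (N ℕ.% (3 ℕ.* a) ℕ.+ k ℕ.* (3 ℕ.* a)) ℕ.* 2  ≤⟨ ℕ.*-monoˡ-≤ 2 (ℕ.+-monoˡ-≤ _ (ℕ.≤-trans (ℕ.m%n≤n N (3 ℕ.* a)) (ℕ.m≤n*m (3 ℕ.* a) k))) ⟩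
    (k ℕ.* (3 ℕ.* a) ℕ.+ k ℕ.* (3 ℕ.* a)) ℕ.* 2  ≡⟨ collect k a ⟩
    k ℕ.* (12 ℕ.* a)                           ∎)
  where
  open ℕ.≤-Reasoning
  instance
    3a≢0 : NonZero (3 ℕ.* a)
    3a≢0 = ℕ.m*n≢0 3 a
  k : ℕ
  k = N ℕ./ (3 ℕ.* a)
  instance
    k≢0 : NonZero k
    k≢0 = ℕ.>-nonZero (ℕ.m≥n⇒m/n>0 3a≤N)
  ka+b≢0 : NonZero (k ℕ.* a ℕ.+ b)
  ka+b≢0 = ℕ.>-nonZero (ℕ.<-≤-trans (ℕ.>-nonZero⁻¹ (k ℕ.* a) {{ℕ.m*n≢0 k a}}) (ℕ.m≤m+n (k ℕ.* a) b))
  collect : ∀ k a → (k ℕ.* (3 ℕ.* a) ℕ.+ k ℕ.* (3 ℕ.* a)) ℕ.* 2 ≡ k ℕ.* (12 ℕ.* a)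
  collect = solve-∀
  regroup : ∀ i k a b → (i ℕ.+ k) ℕ.* a ℕ.+ b ≡ i ℕ.* a ℕ.+ (k ℕ.* a ℕ.+ b)
  regroup = solve-∀
  triple : ∀ k a → k ℕ.* a ℕ.+ (k ℕ.* a ℕ.+ k ℕ.* a) ≡ k ℕ.* (3 ℕ.* a)
  triple = solve-∀
  bounded : ∀ i → i ≤ k → i ℕ.* a ℕ.+ (k ℕ.* a ℕ.+ b) ≤ N
  bounded i i≤k = begin
    i ℕ.* a ℕ.+ (k ℕ.* a ℕ.+ b)        ≤⟨ ℕ.+-mono-≤ (ℕ.*-monoˡ-≤ a i≤k) (ℕ.+-monoʳ-≤ (k ℕ.* a) (ℕ.≤-trans b≤a (ℕ.m≤n*m a k))) ⟩
    k ℕ.* a ℕ.+ (k ℕ.* a ℕ.+ k ℕ.* a)  ≡⟨ triple k a ⟩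
    k ℕ.* (3 ℕ.* a)                    ≤⟨ ℕ.m/n*n≤m N (3 ℕ.* a) ⟩
    N                                  ∎
  term∣M : ∀ i → i ≤ k → i ℕ.* a ℕ.+ (k ℕ.* a ℕ.+ b) ∣ M
  term∣M i i≤k = subst (_∣ M) (regroup i k a b) (∣M (i ℕ.+ k)
    (subst (0 <_) (sym (regroup i k a b)) (ℕ.<-≤-trans (ℕ.>-nonZero⁻¹ _ {{ka+b≢0}}) (ℕ.m≤n+m _ (i ℕ.* a))))
    (subst (_≤ N) (sym (regroup i k a b)) (bounded i i≤k)))

-- The two bounds for `ψ`.

LCM≤ : ∀ {S N} .{{_ : NonZero N}} → (∀ {n} → S n → 0 < n × n ≤ N) → (ℓ : LCM S) →
  LCM.value ℓ ≤ 2 ^ (4 ℕ.* N)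
LCM≤ {S} {N} S⊆[1,N] ℓ with smallCommonMultiple N
... | M , M≢0 , cm , M≤ = ℕ.≤-trans (∣⇒≤ {{ℕ.≢-nonZero M≢0}} (LCM.least ℓ divides-M)) M≤
  where
  divides-M : ∀ {n} → S n → n ∣ M
  divides-M {n} s with n | S⊆[1,N] s
  ... | suc i | _ , i<N = cm i i<N

lemma2p1 : (F : ℤ[x,y]) →
    HasDegree F 2 →
    RepresentsArbitrarilyLarge F →
    LinearlyIndependentOverℚ (∂/∂x F) (∂/∂y F) →
    (A B : ℤ) → A ≢ 0ℤ →
    (∀ (n : ℤ) → Represents F (A * n + B)) →
    ∃[ c ] ∃[ C ] ∃[ N₀ ]
    (0ℚ ℚ.< c × 0ℚ ℚ.< C ×
    (∀ (N : ℕ) → N ≥ N₀ → (ℓ : LCM (PositiveValuesUpTo F N)) →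
    (fromℚ (c ℚ.* (+ N / 1)) ≤ℝ ψ F N ℓ) ×
    (ψ F N ℓ ≤ℝ fromℚ (C ℚ.* (+ N / 1)))))
lemma2p1 F _ _ _ A B A≢0 rep =
  -- The lower constant is 1/(12a), from log 2ᵏ ≥ k/2 and 2N ≤ 12ka. The upper constant is the 4 of
  -- `smallCommonMultiple`, and the threshold 3a ensures k ≥ 1.
  1/1+ (ℕ.pred (12 ℕ.* a)) , + 4 / 1 , 3 ℕ.* a ,
  0<1/1+ (ℕ.pred (12 ℕ.* a)) , ℚ.positive⁻¹ (+ 4 / 1) , bounds
  where
  instance
    A-nonZero : ℤ.NonZero A
    A-nonZero = ℤ.≢-nonZero A≢0
  a b : ℕ
  a = ℤ.∣ A ∣
  b = B ℤ.% A
  instance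
    12a-nonZero : NonZero (12 ℕ.* a)
    12a-nonZero = ℕ.m*n≢0 12 a
  represented : ∀ i → Represents F (+ (i ℕ.* a ℕ.+ b))
  represented i with progression-normalise A B i
  ... | n , eq = subst (Represents F) eq (rep n)
  bounds : ∀ N → N ≥ 3 ℕ.* a → (ℓ : LCM (PositiveValuesUpTo F N)) →
    (fromℚ (1/1+ (ℕ.pred (12 ℕ.* a)) ℚ.* (+ N / 1)) ≤ℝ ψ F N ℓ) ×
    (ψ F N ℓ ≤ℝ fromℚ ((+ 4 / 1) ℚ.* (+ N / 1)))
  bounds N 3a≤N ℓ
    with 2^k≤progressionMultiple a b N (LCM.value ℓ) {{A-nonZero}} {{LCM.nonZero ℓ}} (ℕ.<⇒≤ (ℤ.n%d<d B A)) 3a≤N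
           (λ i 0< ≤N → LCM.commonMultiple ℓ ((0< , ≤N) , represented i))
  ... | k , 2^k≤ , 2N≤ =
    2^k≤⇒≤log {k} {{LCM.nonZero ℓ}} (ℕ.pred (12 ℕ.* a)) N 2^k≤
      (subst (λ x → N ℕ.* 2 ≤ k ℕ.* x) (sym (ℕ.suc-pred (12 ℕ.* a))) 2N≤) ,
    ≤2^⇒log≤ {{LCM.nonZero ℓ}} 4 N (LCM≤ {{N-nonZero}} (λ { (bd , _) → bd }) ℓ)
    where
    N-nonZero : NonZero N
    N-nonZero = ℕ.>-nonZero (ℕ.<-≤-trans (ℕ.>-nonZero⁻¹ (3 ℕ.* a) {{ℕ.m*n≢0 3 a}}) 3a≤N)
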